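{- Let $G$ be a finite Abelian group of odd cardinality. Then $\mathrm{ms}_r(G)=\widetilde{\mathrm{ms}}_r(G)>\frac{1}{r^2}$ for every integer $r\ge 2$.
   Context: $G$ is written additively and carries its normalized counting (Haar) measure $\mu(A)=|A|/|G|$. For $A\subset G$ let $\mathrm{ms}(A)=\max_{c\in G}\mu(A\cap(2c-A))$ (symmetry with respect to central symmetries $x\mapsto 2c-x$) and $\widetilde{\mathrm{ms}}(A)=\max_{c\in G}\mu(A\cap(c-A))$ (symmetry with respect to quasi-central symmetries $x\mapsto c-x$). For an integer $r\ge1$, $\mathrm{ms}_r(G)=\min_\chi\max_{i<r}\mathrm{ms}(\chi^{ -1}(i))$ and $\widetilde{\mathrm{ms}}_r(G)=\min_\chi\max_{i<r}\widetilde{\mathrm{ms}}(\chi^{ -1}(i))$, the minima over all colorings $\chi:G\to\{0,\dots,r-1\}$. -}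

module Defs where

open import Algebra.Bundles using (AbelianGroup)
open import Data.Fin.Base using (Fin; zero; suc; finToFun; funToFin)
open import Data.Fin.Properties using (_≟_; any?; nonZeroIndex; finToFun-funToFin)
open import Data.Integer.Base using (+_)
open import Data.List.Base using (length; filter; tabulate)
open import Data.Nat.Base using (ℕ; suc; _^_; NonZero)
open import Data.Nat.Properties using (m^n≢0)
open import Data.Product.Base using (∃; _×_; _,_)
open import Data.Rational.Base using (ℚ; _/_)
open import Data.Rational.Properties using (≤-decTotalOrder)
open import Relation.Binary.Bundles using (DecTotalOrder)
open import Data.List.Extrema (DecTotalOrder.totalOrder ≤-decTotalOrder) using (max; min)
open import Function.Base using (_∘_)
open import Function.Bundles using (Func; Inverse)
open import Function.Properties.Inverse using (Inverse⇒Injection)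
open import Level using (Level; _⊔_) renaming (suc to lsuc)
import Relation.Binary.Definitions as B
import Relation.Binary.PropositionalEquality as ≡
open ≡ using (_≡_)
open import Relation.Nullary.Decidable using (map′; via-injection; _×-dec_)
open import Relation.Unary using (Pred; Decidable)

private
  variable
    p q : Level

-- The extremum over a nonempty finite index set; the value at zero seeds the
-- fold, so no artificial default value enters.
maximum minimum : (m : ℕ) .{{_ : NonZero m}} → (Fin m → ℚ) → ℚ
maximum (suc m) f = max (f zero) (tabulate (f ∘ suc))
minimum (suc m) f = min (f zero) (tabulate (f ∘ suc))

record FiniteAbelianGroup c ℓ : Set (lsuc (c ⊔ ℓ)) where
  field
    abelianGroup : AbelianGroup c ℓ
    order        : ℕ
    enumeration  : Inverse (AbelianGroup.setoid abelianGroup) (≡.setoid (Fin order))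

  open AbelianGroup abelianGroup public
    renaming (_∙_ to _+_; ∙-cong to +-cong; ε to 0#; _⁻¹ to -_; ⁻¹-cong to -‿cong)
  open Inverse enumeration public using ()
    renaming (to to index; from to element; to-cong to index-cong;
              strictlyInverseʳ to element-index)

  instance
    order-nonZero : NonZero order
    order-nonZero = nonZeroIndex (index 0#)

  infix 4 _≈?_

  _≈?_ : B.Decidable _≈_
  _≈?_ = via-injection (Inverse⇒Injection enumeration) _≟_

module Symmetry {c ℓ} (G : FiniteAbelianGroup c ℓ) where
  open FiniteAbelianGroup G

  -- Decidability costs no generality for the colour classes below, and is what
  -- makes the cardinality of a subset computable.
  record Subset p : Set (c ⊔ ℓ ⊔ lsuc p) where
    field
      Member  : Pred Carrier p
      resp    : Member B.Respects _≈_
      member? : Decidable Member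

  open Subset

  ∣_∣ : Subset p → ℕ
  ∣ A ∣ = length (filter (member? A) (tabulate element))

  μ : Subset p → ℚ
  μ A = + ∣ A ∣ / order

  infixr 7 _∩_
  infix  8 _⊖_

  _∩_ : Subset p → Subset q → Subset (p ⊔ q)
  (A ∩ B) .Member x = Member A x × Member B x
  (A ∩ B) .resp x≈y (x∈A , x∈B) = resp A x≈y x∈A , resp B x≈y x∈B
  (A ∩ B) .member? x = member? A x ×-dec member? B x

  -- d ⊖ A is the set { d - a ∣ a ∈ A }.
  _⊖_ : Carrier → Subset p → Subset (c ⊔ ℓ ⊔ p)
  (d ⊖ A) .Member x = ∃ λ a → Member A a × x ≈ d - a
  (d ⊖ A) .resp x≈y (a , a∈A , x≈d-a) = a , a∈A , trans (sym x≈y) x≈d-a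
  (d ⊖ A) .member? x = map′
    (λ (k , k∈A , eq) → element k , k∈A , eq)
    (λ (a , a∈A , eq) → index a , resp A (sym (element-index a)) a∈A ,
       trans eq (+-cong refl (-‿cong (sym (element-index a)))))
    (any? λ k → member? A (element k) ×-dec (x ≈? (d - element k)))

  ms : Subset p → ℚ
  ms A = maximum order λ k → let d = element k in μ (A ∩ ((d + d) ⊖ A))

  ms~ : Subset p → ℚ
  ms~ A = maximum order λ k → let d = element k in μ (A ∩ (d ⊖ A))

  Colouring : ℕ → Set (c ⊔ ℓ)
  Colouring r = Func setoid (≡.setoid (Fin r))

  preimage : ∀ {r} → Colouring r → Fin r → Subset _
  preimage χ i .Member x = Func.to χ x ≡ i
  preimage χ i .resp x≈y χx≡i = ≡.trans (Func.cong χ (sym x≈y)) χx≡i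
  preimage χ i .member? x = Func.to χ x ≟ i

  colouring : ∀ {r} → Fin (r ^ order) → Colouring r
  colouring k .Func.to   = finToFun k ∘ index
  colouring k .Func.cong = ≡.cong (finToFun k) ∘ index-cong

  colouring-surjective : ∀ {r} (χ : Colouring r) →
                         ∃ λ k → ∀ x → Func.to (colouring k) x ≡ Func.to χ x
  colouring-surjective χ = funToFin (Func.to χ ∘ element) , λ x →
    ≡.trans (finToFun-funToFin (Func.to χ ∘ element) (index x))
            (Func.cong χ (element-index x))

  -- By colouring-surjective, the minima range over all colourings.
  msᵣ ms~ᵣ : (r : ℕ) .{{_ : NonZero r}} → ℚ
  msᵣ r = minimum (r ^ order) {{m^n≢0 r order}} λ k →
            maximum r λ i → ms (preimage (colouring k) i)
  ms~ᵣ r = minimum (r ^ order) {{m^n≢0 r order}} λ k →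
            maximum r λ i → ms~ (preimage (colouring k) i)

{-# OPTIONS --safe #-}

-- For a subset A of G, the function z ↦ ∣A ∩ (z − A)∣ has total ∣A∣².  If no colour
-- class A had a value above ∣G∣/r², then ∣A∣ ≤ ∣G∣/r for every class; as the classes
-- partition G, equality holds throughout, and ∣A ∩ (z − A)∣ = ∣G∣/r² for every z.
-- Now x ↦ z − x is an involution of A ∩ (z − A) whose only possible fixed point is
-- z/2, so ∣A ∩ (z − A)∣ is odd exactly when z/2 ∈ A.  Since it does not depend on z,
-- a nonempty class A is all of G, contradicting ∣A∣ = ∣G∣/r < ∣G∣.
--
-- Doubling is onto because a symmetric matrix has the same sum, mod 2, as its
-- diagonal: apply this to the incidence matrix of x + y = z, whose sum ∣G∣ is odd.
module Submission where

open import Defs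
open import Data.Integer.Base using (+_)
open import Data.Nat.Base using (ℕ; NonZero; _≥_; _^_)
open import Data.Nat.Divisibility using (_∣_)
open import Data.Nat.Properties using (m^n≢0)
open import Data.Product.Base using (_×_)
open import Data.Rational.Base using (_/_; _>_)
open import Relation.Binary.PropositionalEquality using (_≡_)
open import Relation.Nullary using (¬_)

open import Data.Bool.Base using (true; false; if_then_else_)
open import Data.Empty using (⊥)
open import Data.Fin.Base using (Fin; zero; suc; punchOut)
open import Data.Fin.Properties as Fin using (any?; injective⇒≤; punchOut-injective)
import Data.Integer.Base as ℤ
import Data.Integer.Properties as ℤ
open import Data.List.Base using (length; filter; tabulate)
open import Data.List.Properties using (tabulate-cong)
import Data.List.Relation.Unary.All.Properties as All
import Data.List.Relation.Unary.Any.Properties as Any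
open import Data.Nat.Base using (zero; suc; _+_; _*_; _≤_; _<_; z<s; parity; >-nonZero)
open import Data.Nat.Divisibility using (∣m∣n⇒∣m+n; ∣-refl; _∣0)
open import Data.Nat.Properties
open import Data.Nat.Solver using (module +-*-Solver)
open import Algebra.Properties.Semiring.Sum +-*-semiring
open import Data.Parity.Base as ℙ using (1ℙ)
import Data.Parity.Properties as ℙ
open import Data.Product.Base using (∃; ∃₂; _,_; proj₁; proj₂)
open import Data.Rational.Base as ℚ using (ℚ)
import Data.Rational.Properties as ℚ
open import Relation.Binary.Bundles using (DecTotalOrder)
open import Data.Rational.Unnormalised.Base as ℚᵘ using (mkℚᵘ; *<*)
import Data.Rational.Unnormalised.Properties as ℚᵘ
open import Data.List.Extrema (DecTotalOrder.totalOrder ℚ.≤-decTotalOrder) using (max≤v⁺; v≤max⁺; v<min⁺; max; min)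
open import Data.Sum.Base using (inj₁; inj₂)
open import Function.Base using (_∘_)
open import Function.Bundles using (Func; Inverse; _⇔_; mk⇔)
open import Function.Definitions using (Injective)
open import Level using (Level)
open import Relation.Binary.PropositionalEquality
  using (_≢_; _≗_; refl; sym; trans; cong; cong₂; subst; subst₂; module ≡-Reasoning)
open import Relation.Nullary using (Dec; yes; no; does; contradiction)
open import Relation.Nullary.Decidable using (dec-true; dec-false; does-⇔; _×-dec_; decidable-stable)
open import Relation.Unary using (Pred; Decidable)
import Algebra.Properties.Group as GroupProperties

private
  variable
    p q : Level
    n : ℕ

-- Extrema of rational-valued functions

maximum-upper : ∀ m .{{_ : NonZero m}} (f : Fin m → ℚ) k → f k ℚ.≤ maximum m f
maximum-upper (suc m) f zero    = v≤max⁺ (f zero) (tabulate (f ∘ suc)) (inj₁ ℚ.≤-refl)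
maximum-upper (suc m) f (suc k) = v≤max⁺ (f zero) (tabulate (f ∘ suc)) (inj₂ (Any.tabulate⁺ k ℚ.≤-refl))

maximum-least : ∀ m .{{_ : NonZero m}} (f : Fin m → ℚ) {v} →
                (∀ k → f k ℚ.≤ v) → maximum m f ℚ.≤ v
maximum-least (suc m) f f≤v = max≤v⁺ (f≤v zero) (All.tabulate⁺ (f≤v ∘ suc))

maximum-cong : ∀ m .{{_ : NonZero m}} {f g : Fin m → ℚ} → f ≗ g → maximum m f ≡ maximum m g
maximum-cong (suc m) f≗g = cong₂ max (f≗g zero) (tabulate-cong (f≗g ∘ suc))

minimum-cong : ∀ m .{{_ : NonZero m}} {f g : Fin m → ℚ} → f ≗ g → minimum m f ≡ minimum m g
minimum-cong (suc m) f≗g = cong₂ min (f≗g zero) (tabulate-cong (f≗g ∘ suc))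

minimum-> : ∀ m .{{_ : NonZero m}} (f : Fin m → ℚ) {v} →
            (∀ k → v ℚ.< f k) → v ℚ.< minimum m f
minimum-> (suc m) f v<f =
  -- The strict order in `v<min⁺` is `_≤_` paired with `_≢_`, so strictness is translated in both
  -- directions.
  ≤×≢⇒< (v<min⁺ (<⇒≤×≢ (v<f zero)) (All.tabulate⁺ (<⇒≤×≢ ∘ v<f ∘ suc)))
  where
  <⇒≤×≢ : ∀ {x y} → x ℚ.< y → (x ℚ.≤ y) × (x ≢ y)
  <⇒≤×≢ x<y = ℚ.<⇒≤ x<y , ℚ.<⇒≢ x<y

  ≤×≢⇒< : ∀ {x y} → (x ℚ.≤ y) × (x ≢ y) → x ℚ.< y
  ≤×≢⇒< (x≤y , x≢y) = ℚ.≰⇒> (x≢y ∘ ℚ.≤-antisym x≤y)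

-- Cross-multiplication. Since `_/_` reduces to lowest terms, the comparison is made on unnormalised
-- fractions, where numerator and denominator stay visible.
/-mono-< : ∀ a m b n .{{_ : NonZero m}} .{{_ : NonZero n}} →
           a * n < b * m → (+ a) / m ℚ.< (+ b) / n
/-mono-< a (suc m) b (suc n) an<bm = ℚ.toℚᵘ-cancel-<
  (ℚᵘ.<-respˡ-≃ (ℚᵘ.≃-sym (ℚ.toℚᵘ-fromℚᵘ (mkℚᵘ (+ a) m)))
    (ℚᵘ.<-respʳ-≃ (ℚᵘ.≃-sym (ℚ.toℚᵘ-fromℚᵘ (mkℚᵘ (+ b) n)))
      (*<* (subst₂ ℤ._<_ (ℤ.pos-* a (suc n)) (ℤ.pos-* b (suc m)) (ℤ.+<+ an<bm)))))

-- Counting with indicator functions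

-- Only `does` is inspected, so the value reduces in step with `filter` and `_×-dec_`.
𝟙 : {P : Set p} → Dec P → ℕ
𝟙 P? = if does P? then 1 else 0

𝟙-true : {P : Set p} (P? : Dec P) → P → 𝟙 P? ≡ 1
𝟙-true P? p = cong (λ b → if b then 1 else 0) (dec-true P? p)

𝟙-false : {P : Set p} (P? : Dec P) → ¬ P → 𝟙 P? ≡ 0
𝟙-false P? ¬p = cong (λ b → if b then 1 else 0) (dec-false P? ¬p)

𝟙-cong : {P : Set p} {Q : Set q} → P ⇔ Q → (P? : Dec P) (Q? : Dec Q) → 𝟙 P? ≡ 𝟙 Q?
𝟙-cong P⇔Q P? Q? = cong (λ b → if b then 1 else 0) (does-⇔ P⇔Q P? Q?)

𝟙-×-dec : {P : Set p} {Q : Set q} (P? : Dec P) (Q? : Dec Q) → 𝟙 (P? ×-dec Q?) ≡ 𝟙 P? * 𝟙 Q?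
𝟙-×-dec P? Q? with does P? | does Q?
... | false | _     = refl
... | true  | false = refl
... | true  | true  = refl

𝟙-idem : {P : Set p} (P? : Dec P) → 𝟙 P? * 𝟙 P? ≡ 𝟙 P?
𝟙-idem P? with does P?
... | false = refl
... | true  = refl

length-filter-tabulate : ∀ {a} {A : Set a} {P : Pred A p} (P? : Decidable P) (f : Fin n → A) →
                         length (filter P? (tabulate f)) ≡ ∑[ i < n ] 𝟙 (P? (f i))
length-filter-tabulate {n = zero}  P? f = refl
length-filter-tabulate {n = suc n} P? f with does (P? (f zero))
... | false = length-filter-tabulate P? (f ∘ suc)
... | true  = cong suc (length-filter-tabulate P? (f ∘ suc))

sum-zero : {f : Fin n → ℕ} → (∀ i → f i ≡ 0) → sum f ≡ 0
sum-zero {n = n} f≡0 = trans (sum-cong-≗ f≡0) (sum-replicate-zero n)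

sum-const : ∀ n x → ∑[ _ < n ] x ≡ n * x
sum-const zero    x = refl
sum-const (suc n) x = cong (λ s → x + s) (sum-const n x)

-- Sifting: only the term at `k` survives. `P` is any predicate with `k` as its sole solution, so
-- that an equation in the group can be used directly.
sum-𝟙 : {P : Pred (Fin n) p} (g : Fin n → ℕ) (P? : Decidable P) (k : Fin n) →
        P k → (∀ {j} → P j → j ≡ k) → ∑[ j < n ] (g j * 𝟙 (P? j)) ≡ g k
sum-𝟙 {n = suc n} g P? zero pk unique = begin
  g zero * 𝟙 (P? zero) + _  ≡⟨ cong₂ _+_ (cong (g zero *_) (𝟙-true (P? zero) pk)) (sum-zero λ j →
                                 trans (cong (g (suc j) *_) (𝟙-false (P? (suc j)) ((λ ()) ∘ unique)))
                                       (*-zeroʳ (g (suc j)))) ⟩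
  g zero * 1 + 0  ≡⟨ +-identityʳ _ ⟩
  g zero * 1      ≡⟨ *-identityʳ _ ⟩
  g zero          ∎
  where open ≡-Reasoning
sum-𝟙 {n = suc n} g P? (suc k) pk unique = begin
  g zero * 𝟙 (P? zero) + _  ≡⟨ cong₂ _+_ (cong (g zero *_) (𝟙-false (P? zero) ((λ ()) ∘ unique)))
                                 (sum-𝟙 (g ∘ suc) (P? ∘ suc) k pk (Fin.suc-injective ∘ unique)) ⟩
  g zero * 0 + g (suc k)  ≡⟨ cong (_+ g (suc k)) (*-zeroʳ (g zero)) ⟩
  g (suc k)               ∎
  where open ≡-Reasoning

sum-mono-≤ : {f g : Fin n → ℕ} → (∀ i → f i ≤ g i) → sum f ≤ sum g
sum-mono-≤ {n = zero}  f≤g = ≤-refl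
sum-mono-≤ {n = suc n} f≤g = +-mono-≤ (f≤g zero) (sum-mono-≤ (f≤g ∘ suc))

-- A deficit in one term could not be made good by the others, as none of them exceeds its bound.
-- This turns the averaging inequalities for the colour classes into equalities.
sum-≡⇒≗ : {f g : Fin n → ℕ} → (∀ i → f i ≤ g i) → sum f ≡ sum g → f ≗ g
sum-≡⇒≗ {n = suc n} {f} {g} f≤g Σf≡Σg = λ where
    zero    → head≡
    (suc i) → sum-≡⇒≗ (f≤g ∘ suc)
                (+-cancelˡ-≡ (g zero) _ _ (trans (cong (_+ sum (f ∘ suc)) (sym head≡)) Σf≡Σg)) i
  where
  head≡ : f zero ≡ g zero
  head≡ = ≤-antisym (f≤g zero) (+-cancelʳ-≤ (sum (f ∘ suc)) _ _
    (≤-trans (+-monoʳ-≤ (g zero) (sum-mono-≤ (f≤g ∘ suc))) (≤-reflexive (sym Σf≡Σg))))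

-- Pigeonhole: if `y` were missed, punching it out would inject `Fin (suc n)` into `Fin n`.
injective⇒surjective : {f : Fin n → Fin n} → Injective _≡_ _≡_ f → ∀ y → ∃ λ x → f x ≡ y
injective⇒surjective {n = suc n} {f} f-inj y with any? (λ x → f x Fin.≟ y)
... | yes x,fx≡y = x,fx≡y
... | no  y∉f    = contradiction
  (injective⇒≤ (λ {i} {j} → f-inj ∘ punchOut-injective (y≢f i) (y≢f j))) 1+n≰n
  where
  y≢f : ∀ x → y ≢ f x
  y≢f x y≡fx = y∉f (x , sym y≡fx)

-- Parity

∤2⇒odd : ∀ n → ¬ (2 ∣ n) → parity n ≡ 1ℙ
∤2⇒odd 0             2∤n = contradiction (2 ∣0) 2∤n
∤2⇒odd 1             2∤n = refl
∤2⇒odd (suc (suc n)) 2∤n = ∤2⇒odd n (2∤n ∘ ∣m∣n⇒∣m+n ∣-refl)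

parity-double+ : ∀ m n → parity (m + m + n) ≡ parity n
parity-double+ m n = begin
  parity (m + m + n)                  ≡⟨ ℙ.+-homo-+ (m + m) n ⟩
  parity (m + m) ℙ.+ parity n         ≡⟨ cong (ℙ._+ parity n) (ℙ.+-homo-+ m m) ⟩
  parity m ℙ.+ parity m ℙ.+ parity n  ≡⟨ cong (ℙ._+ parity n) (ℙ.p+p≡0ℙ (parity m)) ⟩
  parity n                            ∎
  where open ≡-Reasoning

-- Entries off the diagonal come in equal pairs. In the induction, the rest of the first row and the
-- rest of the first column both sum to `s`, and `s + s` is even.
parity-symmetric : (F : Fin n → Fin n → ℕ) → (∀ i j → F i j ≡ F j i) →
                   parity (∑[ i < n ] ∑[ j < n ] F i j) ≡ parity (∑[ i < n ] F i i)
parity-symmetric {n = zero}  F F-sym = refl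
parity-symmetric {n = suc n} F F-sym = begin
  parity (d + s + ∑[ i < n ] (F (suc i) zero + ∑[ j < n ] F (suc i) (suc j)))
    ≡⟨ cong (λ t → parity (d + s + t)) (∑-distrib-+ (λ i → F (suc i) zero) _) ⟩
  parity (d + s + (∑[ i < n ] F (suc i) zero + t))
    ≡⟨ cong (λ u → parity (d + s + (u + t))) (sum-cong-≗ λ i → F-sym (suc i) zero) ⟩
  parity (d + s + (s + t))
    ≡⟨ cong parity (solve 3 (λ d s t → d :+ s :+ (s :+ t) := s :+ s :+ (d :+ t)) refl d s t) ⟩
  parity (s + s + (d + t))
    ≡⟨ parity-double+ s (d + t) ⟩
  parity (d + t)
    ≡⟨ ℙ.+-homo-+ d t ⟩
  parity d ℙ.+ parity t
    ≡⟨ cong (parity d ℙ.+_) (parity-symmetric (λ i j → F (suc i) (suc j)) (λ i j → F-sym (suc i) (suc j))) ⟩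
  parity d ℙ.+ parity (∑[ i < n ] F (suc i) (suc i))
    ≡⟨ ℙ.+-homo-+ d _ ⟨
  parity (d + ∑[ i < n ] F (suc i) (suc i))
    ∎
  where
  open ≡-Reasoning
  open +-*-Solver
  d = F zero zero
  s = ∑[ j < n ] F zero (suc j)
  t = ∑[ i < n ] ∑[ j < n ] F (suc i) (suc j)

-- Sums of two elements in a finite group

module Convolution {c ℓ} (G : FiniteAbelianGroup c ℓ) where
  module G = FiniteAbelianGroup G
  open G using (order; element; index; index-cong; element-index; _≈_; _≈?_)
  open Symmetry G
  open Subset
  open GroupProperties G.group using (x≈z//y; //-rightDividesˡ)

  index-element : ∀ k → index (element k) ≡ k
  index-element = Inverse.strictlyInverseˡ G.enumeration

  element-injective : ∀ {i j} → element i ≈ element j → i ≡ j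
  element-injective {i} {j} eq =
    trans (sym (index-element i)) (trans (index-cong eq) (index-element j))

  [_⊕_≡_] : Fin order → Fin order → Fin order → ℕ
  [ x ⊕ y ≡ z ] = 𝟙 (element x G.+ element y ≈? element z)

  ⊕-comm : ∀ x y z → [ x ⊕ y ≡ z ] ≡ [ y ⊕ x ≡ z ]
  ⊕-comm x y z = 𝟙-cong (mk⇔ (G.trans (G.comm _ _)) (G.trans (G.comm _ _)))
    (element x G.+ element y ≈? element z) (element y G.+ element x ≈? element z)

  -- The convolution of `f` with itself. The double sum over pairs, in place of a single sum of
  -- `f x` times `f` at z - x, keeps the symmetry in `x` and `y` visible and lets the sums be
  -- exchanged.
  autoconvolution : (Fin order → ℕ) → Fin order → ℕ
  autoconvolution f z = ∑[ x < order ] ∑[ y < order ] (f x * (f y * [ x ⊕ y ≡ z ]))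

  sum-summand : ∀ g x z → ∑[ y < order ] (g y * [ x ⊕ y ≡ z ]) ≡ g (index (element z G.- element x))
  sum-summand g x z = sum-𝟙 g (λ y → element x G.+ element y ≈? element z) _
    (G.trans (G.comm _ _) (G.trans (G.+-cong (element-index _) G.refl) (//-rightDividesˡ _ _)))
    (λ {y} eq → trans (sym (index-element y)) (index-cong (x≈z//y _ _ _ (G.trans (G.comm _ _) eq))))

  sum-total : ∀ x y → ∑[ z < order ] [ x ⊕ y ≡ z ] ≡ 1
  sum-total x y = trans (sum-cong-≗ {order} (λ z → sym (*-identityˡ [ x ⊕ y ≡ z ])))
    (sum-𝟙 (λ _ → 1) (λ z → element x G.+ element y ≈? element z) (index (element x G.+ element y))
      (G.sym (element-index _))
      (λ {z} eq → trans (sym (index-element z)) (index-cong (G.sym eq))))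

  -- Each pair has exactly one sum `z`, so summing over `z` first leaves the unrestricted sum of
  -- `f x * f y`.
  autoconvolution-total : ∀ f → ∑[ z < order ] autoconvolution f z ≡ sum f * sum f
  autoconvolution-total f = begin
    ∑[ z < order ] ∑[ x < order ] ∑[ y < order ] (f x * (f y * [ x ⊕ y ≡ z ]))
      ≡⟨ ∑-comm (λ z x → ∑[ y < order ] (f x * (f y * [ x ⊕ y ≡ z ]))) ⟩
    ∑[ x < order ] ∑[ z < order ] ∑[ y < order ] (f x * (f y * [ x ⊕ y ≡ z ]))
      ≡⟨ sum-cong-≗ {order} (λ x → ∑-comm (λ z y → f x * (f y * [ x ⊕ y ≡ z ]))) ⟩
    ∑[ x < order ] ∑[ y < order ] ∑[ z < order ] (f x * (f y * [ x ⊕ y ≡ z ]))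
      ≡⟨ sum-cong-≗ {order} (λ x → sum-cong-≗ {order} (λ y → total x y)) ⟩
    ∑[ x < order ] ∑[ y < order ] (f x * f y)
      ≡⟨ sum-cong-≗ {order} (λ x → sym (*-distribˡ-sum (f x) f)) ⟩
    ∑[ x < order ] (f x * sum f)
      ≡⟨ *-distribʳ-sum (sum f) f ⟨
    sum f * sum f
      ∎
    where
    open ≡-Reasoning
    total : ∀ x y → ∑[ z < order ] (f x * (f y * [ x ⊕ y ≡ z ])) ≡ f x * f y
    total x y = begin
      ∑[ z < order ] (f x * (f y * [ x ⊕ y ≡ z ]))  ≡⟨ sum-cong-≗ {order} (λ z → sym (*-assoc (f x) (f y) _)) ⟩
      ∑[ z < order ] (f x * f y * [ x ⊕ y ≡ z ])    ≡⟨ *-distribˡ-sum (f x * f y) (λ z → [ x ⊕ y ≡ z ]) ⟨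
      f x * f y * ∑[ z < order ] [ x ⊕ y ≡ z ]      ≡⟨ cong (f x * f y *_) (sum-total x y) ⟩
      f x * f y * 1                                 ≡⟨ *-identityʳ _ ⟩
      f x * f y                                     ∎

  -- The involution x ↦ z - x in matrix form: the pairs (x, y) and (y, x) cancel mod 2, and the
  -- fixed points, where x + x = z, remain.
  parity-autoconvolution : ∀ f z → parity (autoconvolution f z) ≡
                           parity (∑[ x < order ] (f x * (f x * [ x ⊕ x ≡ z ])))
  parity-autoconvolution f z = parity-symmetric _ λ x y → begin
    f x * (f y * [ x ⊕ y ≡ z ])  ≡⟨ *-assoc (f x) (f y) _ ⟨
    f x * f y * [ x ⊕ y ≡ z ]    ≡⟨ cong₂ _*_ (*-comm (f x) (f y)) (⊕-comm x y z) ⟩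
    f y * f x * [ y ⊕ x ≡ z ]    ≡⟨ *-assoc (f y) (f x) _ ⟩
    f y * (f x * [ y ⊕ x ≡ z ])  ∎
    where open ≡-Reasoning

  indicator : Subset p → Fin order → ℕ
  indicator A x = 𝟙 (member? A (element x))

  ∣∣-sum : (A : Subset p) → ∣ A ∣ ≡ sum (indicator A)
  ∣∣-sum A = length-filter-tabulate (member? A) element

  -- An element x lies in z - A exactly when z - x lies in A, so each element of the intersection
  -- accounts for one pair from A with sum z.
  ∣A∩z⊖A∣ : (A : Subset p) (z : Fin order) → ∣ A ∩ (element z ⊖ A) ∣ ≡ autoconvolution (indicator A) z
  ∣A∩z⊖A∣ A z = trans (∣∣-sum (A ∩ (element z ⊖ A))) (sum-cong-≗ {order} λ x → begin
    indicator (A ∩ (element z ⊖ A)) x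
      ≡⟨ 𝟙-×-dec (member? A (element x)) (member? (element z ⊖ A) (element x)) ⟩
    indicator A x * indicator (element z ⊖ A) x
      ≡⟨ cong (indicator A x *_) (𝟙-cong (reflected x) (member? (element z ⊖ A) (element x)) (member? A _)) ⟩
    indicator A x * indicator A (index (element z G.- element x))
      ≡⟨ cong (indicator A x *_) (sum-summand (indicator A) x z) ⟨
    indicator A x * ∑[ y < order ] (indicator A y * [ x ⊕ y ≡ z ])
      ≡⟨ *-distribˡ-sum (indicator A x) (λ y → indicator A y * [ x ⊕ y ≡ z ]) ⟩
    ∑[ y < order ] (indicator A x * (indicator A y * [ x ⊕ y ≡ z ]))
      ∎)
    where
    open ≡-Reasoning
    reflection-sym : ∀ {u v w} → u ≈ w G.- v → v ≈ w G.- u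
    reflection-sym {u} {v} {w} eq = x≈z//y v u w
      (G.trans (G.comm v u) (G.trans (G.+-cong eq G.refl) (//-rightDividesˡ v w)))

    reflected : ∀ x → Member (element z ⊖ A) (element x) ⇔
                      Member A (element (index (element z G.- element x)))
    reflected x = mk⇔
      (λ (a , a∈A , eq) → resp A (G.trans (reflection-sym eq) (G.sym (element-index _))) a∈A)
      (λ m → _ , m , reflection-sym (element-index _))

-- Halving in a group of odd order

module OddOrder {c ℓ} (G : FiniteAbelianGroup c ℓ) (2∤order : ¬ (2 ∣ FiniteAbelianGroup.order G)) where
  open Convolution G
  open G using (order; element; index; element-index; _≈_; _≈?_)
  open Symmetry G
  open Subset

  odd-order : parity order ≡ 1ℙ
  odd-order = ∤2⇒odd order 2∤order

  -- With constant weight 1 the convolution at `z` equals the odd number `order`, while its diagonal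
  -- part counts the halves of `z`. If there were none, an odd number would have the parity of 0.
  halvable : ∀ z → ∃ λ x → element x G.+ element x ≈ element z
  -- The search over `Fin order` is decidable, so refuting its failure yields a witness.
  halvable z = decidable-stable (any? λ x → element x G.+ element x ≈? element z) λ ∄ →
    contradiction (begin
      1ℙ                                                 ≡⟨ odd-order ⟨
      parity order                                       ≡⟨ cong parity pairs ⟨
      parity (autoconvolution (λ _ → 1) z)               ≡⟨ parity-autoconvolution (λ _ → 1) z ⟩
      parity (∑[ x < order ] (1 * (1 * [ x ⊕ x ≡ z ])))  ≡⟨ cong parity (sum-zero {order} λ x →
                                                           cong (λ t → 1 * (1 * t)) (𝟙-false (_ ≈? _) (∄ ∘ (x ,_)))) ⟩
      ℙ.0ℙ                                            ∎) λ ()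
    where
    open ≡-Reasoning
    pairs : autoconvolution (λ _ → 1) z ≡ order
    pairs = begin
      ∑[ x < order ] ∑[ y < order ] (1 * (1 * [ x ⊕ y ≡ z ]))
        ≡⟨ sum-cong-≗ {order} (λ x → trans (sum-cong-≗ {order} (λ y → *-identityˡ _)) (sum-summand (λ _ → 1) x z)) ⟩
      ∑[ x < order ] 1
        ≡⟨ trans (sum-const order 1) (*-identityʳ order) ⟩
      order
        ∎

  half : Fin order → Fin order
  half z = proj₁ (halvable z)

  half+half : ∀ z → element (half z) G.+ element (half z) ≈ element z
  half+half z = proj₂ (halvable z)

  half-injective : Injective _≡_ _≡_ half
  half-injective {x} {y} eq = element-injective (G.trans (G.sym (half+half x))
    (subst (λ h → element h G.+ element h ≈ element y) (sym eq) (half+half y)))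

  -- Doubling undoes `half`, so `half` is injective and, by finiteness, onto. Hence `x` is the half
  -- of some `y`, and doubling identifies `y` with `z`.
  half-unique : ∀ {x z} → element x G.+ element x ≈ element z → x ≡ half z
  half-unique {x} {z} eq with injective⇒surjective half-injective x
  ... | y , refl = cong half (element-injective (G.trans (G.sym (half+half y)) eq))

  -- The diagonal has a single nonzero position, z/2, and the square of the indicator there is the
  -- indicator itself.
  parity-autoconvolution-half : (A : Subset p) (z : Fin order) →
                                parity (autoconvolution (indicator A) z) ≡ parity (indicator A (half z))
  parity-autoconvolution-half A z = trans (parity-autoconvolution (indicator A) z) (cong parity (begin
    ∑[ x < order ] (indicator A x * (indicator A x * [ x ⊕ x ≡ z ]))
      ≡⟨ sum-cong-≗ {order} (λ x → trans (sym (*-assoc (indicator A x) (indicator A x) _))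
           (cong (_* [ x ⊕ x ≡ z ]) (𝟙-idem (member? A (element x))))) ⟩
    ∑[ x < order ] (indicator A x * [ x ⊕ x ≡ z ])
      ≡⟨ sum-𝟙 (indicator A) (λ x → element x G.+ element x ≈? element z) (half z) (half+half z) half-unique ⟩
    indicator A (half z)
      ∎))
    where open ≡-Reasoning

  -- The parity of the common value records whether z/2 lies in `A`. It is odd at `z₀`, hence odd at
  -- every z, and the halves exhaust the group.
  constant⇒full : (A : Subset p) → (∀ z z′ → autoconvolution (indicator A) z ≡ autoconvolution (indicator A) z′) →
                  ∀ {z₀} → Member A (element (half z₀)) → sum (indicator A) ≡ order
  constant⇒full A const {z₀} m₀ = begin
    sum (indicator A)  ≡⟨ sum-cong-≗ {order} everywhere ⟩
    ∑[ x < order ] 1   ≡⟨ sum-const order 1 ⟩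
    order * 1          ≡⟨ *-identityʳ order ⟩
    order              ∎
    where
    open ≡-Reasoning
    odd⇒1 : ∀ x → parity (indicator A x) ≡ 1ℙ → indicator A x ≡ 1
    odd⇒1 x odd with does (member? A (element x))
    -- For `false` the hypothesis would equate `0ℙ` with `1ℙ`, so that case is empty.
    ... | true  = refl

    everywhere : ∀ x → indicator A x ≡ 1
    everywhere x with injective⇒surjective half-injective x
    ... | z , refl = odd⇒1 (half z) (begin
      parity (indicator A (half z))              ≡⟨ parity-autoconvolution-half A z ⟨
      parity (autoconvolution (indicator A) z)   ≡⟨ cong parity (const z z₀) ⟩
      parity (autoconvolution (indicator A) z₀)  ≡⟨ parity-autoconvolution-half A z₀ ⟩
      parity (indicator A (half z₀))             ≡⟨ cong parity (𝟙-true (member? A _) m₀) ⟩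
      1ℙ                                         ∎)

  -- Both maxima run over the same reflections: each 2c is an element of the group, and each z is
  -- the double of its half.
  ms≡ms~ : (A : Subset p) → ms A ≡ ms~ A
  ms≡ms~ A = ℚ.≤-antisym
    (maximum-least order _ λ k → subst (ℚ._≤ ms~ A)
      (μ-cong (element-index (element k G.+ element k)))
      (maximum-upper order _ (index (element k G.+ element k))))
    (maximum-least order _ λ k → subst (ℚ._≤ ms A)
      (μ-cong (half+half k))
      (maximum-upper order _ (half k)))
    where
    -- Centres agree only up to `_≈_`, so equality of the measures has to be derived by counting.
    μ-cong : ∀ {d e} → d ≈ e → μ (A ∩ (d ⊖ A)) ≡ μ (A ∩ (e ⊖ A))
    μ-cong {d} {e} d≈e = cong (λ k → (+ k) / order) (begin
      ∣ A ∩ (d ⊖ A) ∣                ≡⟨ ∣∣-sum (A ∩ (d ⊖ A)) ⟩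
      sum (indicator (A ∩ (d ⊖ A)))  ≡⟨ sum-cong-≗ {order} (λ x → 𝟙-cong (mk⇔
        (λ (m , a , a∈A , eq) → m , a , a∈A , G.trans eq (G.+-cong d≈e G.refl))
        (λ (m , a , a∈A , eq) → m , a , a∈A , G.trans eq (G.+-cong (G.sym d≈e) G.refl)))
        (member? (A ∩ (d ⊖ A)) (element x)) (member? (A ∩ (e ⊖ A)) (element x))) ⟩
      sum (indicator (A ∩ (e ⊖ A)))  ≡⟨ ∣∣-sum (A ∩ (e ⊖ A)) ⟨
      ∣ A ∩ (e ⊖ A) ∣                ∎)
      where open ≡-Reasoning

  -- Colour classes and the counting contradiction

  module _ {r} (χ : Colouring r) where

    f : Fin r → Fin order → ℕ
    f i = indicator (preimage χ i)

    classes-total : ∑[ i < r ] sum (f i) ≡ order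
    classes-total = begin
      ∑[ i < r ] ∑[ x < order ] f i x  ≡⟨ ∑-comm f ⟩
      ∑[ x < order ] ∑[ i < r ] f i x  ≡⟨ sum-cong-≗ {order} (λ x →
        trans (sum-cong-≗ {r} (λ i → sym (*-identityˡ (f i x))))
              (sum-𝟙 (λ _ → 1) (λ i → Func.to χ (element x) Fin.≟ i) (Func.to χ (element x)) refl sym)) ⟩
      ∑[ x < order ] 1  ≡⟨ trans (sum-const order 1) (*-identityʳ order) ⟩
      order             ∎
      where open ≡-Reasoning

    -- The negation of the desired bound, multiplied out so that the argument stays in ℕ.
    module _ (r≥2 : r ≥ 2) (small : ∀ i z → r * r * autoconvolution (f i) z ≤ order) where

      scaled-total : ∀ i → ∑[ z < order ] (r * r * autoconvolution (f i) z) ≡ (r * sum (f i)) * (r * sum (f i))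
      scaled-total i = begin
        ∑[ z < order ] (r * r * autoconvolution (f i) z)  ≡⟨ *-distribˡ-sum (r * r) (autoconvolution (f i)) ⟨
        r * r * ∑[ z < order ] autoconvolution (f i) z    ≡⟨ cong (r * r *_) (autoconvolution-total (f i)) ⟩
        r * r * (sum (f i) * sum (f i))                   ≡⟨ [m*n]*[o*p]≡[m*o]*[n*p] r r (sum (f i)) (sum (f i)) ⟩
        r * sum (f i) * (r * sum (f i))                   ∎
        where open ≡-Reasoning

      -- Averaging over z: the scaled values sum to the square of `r * sum (f i)`, and each of the
      -- `order` many values is at most `order`.
      class-small : ∀ i → r * sum (f i) ≤ order
      class-small i = ≮⇒≥ λ order<ra → <⇒≱ (*-mono-< order<ra order<ra) (begin
        r * sum (f i) * (r * sum (f i))                   ≡⟨ scaled-total i ⟨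
        ∑[ z < order ] (r * r * autoconvolution (f i) z)  ≤⟨ sum-mono-≤ (small i) ⟩
        ∑[ z < order ] order                              ≡⟨ sum-const order order ⟩
        order * order                                     ∎)
        where open ≤-Reasoning

      -- The classes partition the group, so the upper bounds of `class-small` are already attained
      -- in total.
      class-size : ∀ i → r * sum (f i) ≡ order
      class-size = sum-≡⇒≗ class-small (begin
        ∑[ i < r ] (r * sum (f i))  ≡⟨ *-distribˡ-sum r (λ i → sum (f i)) ⟨
        r * ∑[ i < r ] sum (f i)    ≡⟨ cong (r *_) classes-total ⟩
        r * order                   ≡⟨ sum-const r order ⟨
        ∑[ i < r ] order            ∎)
        where open ≡-Reasoning

      -- With the class size known exactly, the bounds in `small` are attained in total, so the
      -- convolution is constant.
      autoconvolution-size : ∀ i z → r * r * autoconvolution (f i) z ≡ order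
      autoconvolution-size i = sum-≡⇒≗ (small i) (begin
        ∑[ z < order ] (r * r * autoconvolution (f i) z)  ≡⟨ scaled-total i ⟩
        r * sum (f i) * (r * sum (f i))                   ≡⟨ cong₂ _*_ (class-size i) (class-size i) ⟩
        order * order                                     ≡⟨ sum-const order order ⟨
        ∑[ z < order ] order                              ∎)
        where open ≡-Reasoning

      ¬small : ⊥
      ¬small = <⇒≢ (m<m*n order r r≥2) (begin
        order          ≡⟨ class-size i ⟨
        r * sum (f i)  ≡⟨ cong (r *_) full ⟩
        r * order      ≡⟨ *-comm r order ⟩
        order * r      ∎)
        where
        open ≡-Reasoning
        -- The class is chosen as the colour of a concrete element, which makes it nonempty with
        -- membership proved by `refl`.
        z₀ = index G.0#
        i  = Func.to χ (element (half z₀))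
        instance
          r≢0 : NonZero r
          r≢0 = >-nonZero (<-trans z<s r≥2)
        full : sum (f i) ≡ order
        full = constant⇒full (preimage χ i)
          (λ z z′ → *-cancelˡ-≡ _ _ (r * r) {{m*n≢0 r r}}
            (trans (autoconvolution-size i z) (sym (autoconvolution-size i z′))))
          {z₀} refl

    -- Colours and centres form finite sets, so the contradiction from `¬small` gives an actual
    -- colour and centre.
    large-class : r ≥ 2 → ∃₂ λ i z → order < r * r * autoconvolution (f i) z
    large-class r≥2 = decidable-stable
      (any? λ i → any? λ z → order <? r * r * autoconvolution (f i) z)
      λ ∄ → ¬small r≥2 λ i z → ≮⇒≥ λ large → ∄ (i , z , large)

  -- Passage to rational measures and the final bound

  ms~-large : ∀ r .{{_ : NonZero r}} (r≥2 : r ≥ 2) (χ : Colouring r) →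
              ((+ 1) / (r ^ 2)) {{m^n≢0 r 2}} ℚ.< maximum r (λ i → ms~ (preimage χ i))
  ms~-large r r≥2 χ with large-class χ r≥2
  ... | i , z , large = begin-strict
    ((+ 1) / (r ^ 2)) {{m^n≢0 r 2}}
      <⟨ /-mono-< 1 (r ^ 2) ∣ A ∩ (element z ⊖ A) ∣ order {{m^n≢0 r 2}} large′ ⟩
    μ (A ∩ (element z ⊖ A))
      ≤⟨ maximum-upper order _ z ⟩
    ms~ A
      ≤⟨ maximum-upper r _ i ⟩
    maximum r (λ i → ms~ (preimage χ i))
      ∎
    where
    open ℚ.≤-Reasoning
    A = preimage χ i

    large′ : 1 * order < ∣ A ∩ (element z ⊖ A) ∣ * r ^ 2
    large′ = subst₂ _<_ (sym (*-identityˡ order))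
      (trans (*-comm (r * r) _)
        -- `r ^ 2` unfolds to `r * (r * 1)`, hence the identity law inside the product.
        (cong₂ _*_ (sym (∣A∩z⊖A∣ A z)) (cong (r *_) (sym (*-identityʳ r)))))
      large

theorem7p6 : ∀ {c ℓ} (G : FiniteAbelianGroup c ℓ) →
    ¬ (2 ∣ FiniteAbelianGroup.order G) →
    (r : ℕ) .{{_ : NonZero r}} → r ≥ 2 →
    (Symmetry.msᵣ G r ≡ Symmetry.ms~ᵣ G r) ×
    (Symmetry.msᵣ G r > ((+ 1) / (r ^ 2)) {{m^n≢0 r 2}})
-- The bound is obtained for `ms~ᵣ`, where the centres are arbitrary elements z as in the
-- convolution, and carried over along the equality.
theorem7p6 G 2∤order r r≥2 = msᵣ≡ms~ᵣ , subst (_> ((+ 1) / (r ^ 2)) {{m^n≢0 r 2}}) (sym msᵣ≡ms~ᵣ)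
    (minimum-> (r ^ order) {{m^n≢0 r order}} _ λ k → ms~-large r r≥2 (colouring k))
  where
  open FiniteAbelianGroup G using (order)
  open Symmetry G
  open OddOrder G 2∤order
  msᵣ≡ms~ᵣ : msᵣ r ≡ ms~ᵣ r
  msᵣ≡ms~ᵣ = minimum-cong (r ^ order) {{m^n≢0 r order}} λ k →
    maximum-cong r λ i → ms≡ms~ (preimage (colouring k) i)
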